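{- Let $R=K[x,y,z]$ with $\operatorname{char} K = 0$, and let $I\subset R$ be an Artinian ideal whose minimal monomial generators have degrees $d_1,\ldots,d_t$. Set $$d := \frac{d_1+\cdots+d_t}{t-1}.$$ Assume that the following conditions are satisfied: (i) The number $d$ is an integer. (ii) For all $i=1,\ldots,t$, one has $d>d_i$. (iii) Each degree of a least common multiple of two distinct minimal generators of $I$ is at least $d$. Then the syzygy bundle of $I$ is semistable if $R/I$ has the weak Lefschetz property.
   Context: $I$ is a monomial ideal. An Artinian standard graded $K$-algebra $A$ has the weak Lefschetz property if there is a linear form $\ell\in[A]_1$ such that for all integers $j$ the multiplication map $\times\ell:[A]_j\to[A]_{j+1}$ has maximal rank (is injective or surjective). If $g_1,\dots,g_t$ are the minimal monomial generators of $I$, the syzygy module $\operatorname{syz} I$ is the kernel of the surjection $\bigoplus_{i=1}^t R(-\deg g_i)\to I$, and the syzygy bundle of $I$ is its sheafification on $\mathbb{P}^2$, of rank $t-1$. A vector bundle $E$ is semistable if $\mu(F)\le\mu(E)$ for every non-zero coherent subsheaf $F\subset E$, where $\mu=c_1/\operatorname{rk}$. (By a theorem of Brenner, for monomial ideals in characteristic zero this is equivalent to: for every proper subset $J\subset\{1,\dots,t\}$ with at least two elements, $\frac{d_J-\sum_{j\in J}\deg g_j}{|J|-1}\le\frac{ -\sum_{i=1}^t\deg g_i}{t-1}$, where $d_J$ is the degree of $\gcd\{g_j: j\in J\}$; this may be taken as the definition of semistability.) -}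

module Defs where

open import Algebra.Apartness.Bundles using (HeytingField; HeytingCommutativeRing)
import Algebra.Definitions.RawMonoid as RawMonoidDefinitions
open import Algebra.Bundles using (CommutativeRing)
open import Data.Bool.Base using (true; false)
open import Data.Fin.Base using (Fin)
open import Data.Fin.Subset using (Subset; ⊤; ∣_∣; _⊂_)
open import Data.Integer.Base as ℤ using (+_)
open import Data.List.Base as List using (List; []; _∷_; _++_)
open import Data.List.Relation.Unary.All as All using (All)
import Data.List.Relation.Unary.All.Properties as All
open import Data.Nat.Base as ℕ using (ℕ; suc; NonZero; _∸_; _⊓_)
import Data.Nat.Properties as ℕ
open import Data.Product.Base using (Σ; ∃; _×_; _,_; proj₁; proj₂)
open import Data.Rational.Base as ℚ using (_/_)
open import Data.Sum.Base using (_⊎_)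
open import Data.Vec.Base as Vec using (Vec; []; _∷_; lookup)
open import Data.Vec.Properties using (≡-dec)
open import Function.Base using (_∘_; _on_)
open import Function.Definitions using (Injective; StrictlySurjective)
open import Level using (_⊔_) renaming (suc to lsuc)
open import Relation.Binary.Core using (Rel)
open import Relation.Binary.Definitions using (DecidableEquality)
open import Relation.Binary.PropositionalEquality
  using (_≡_; _≢_; refl; trans; cong; cong₂; setoid)
open import Relation.Nullary.Negation using (¬_)
open import Relation.Unary using (Pred; _⊆_)
open import Algebra.Properties.CommutativeSemigroup ℕ.+-commutativeSemigroup
  using (interchange)

-- Monomials in x, y, z, given by their exponent vectors.
Monomial : Set
Monomial = Vec ℕ 3

_≟ᵐ_ : DecidableEquality Monomial
_≟ᵐ_ = ≡-dec ℕ._≟_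

1ᵐ : Monomial
1ᵐ = Vec.replicate 3 0

infixl 7 _·ᵐ_
_·ᵐ_ : Monomial → Monomial → Monomial
_·ᵐ_ = Vec.zipWith ℕ._+_

lcmᵐ : Monomial → Monomial → Monomial
lcmᵐ = Vec.zipWith ℕ._⊔_

gcdᵐ : Monomial → Monomial → Monomial
gcdᵐ = Vec.zipWith _⊓_

deg : Monomial → ℕ
deg = Vec.sum

deg-·ᵐ : ∀ u v → deg (u ·ᵐ v) ≡ deg u ℕ.+ deg v
deg-·ᵐ = go
  where
  go : ∀ {n} (u v : Vec ℕ n) →
       Vec.sum (Vec.zipWith ℕ._+_ u v) ≡ Vec.sum u ℕ.+ Vec.sum v
  go []      []      = refl
  go (a ∷ u) (b ∷ v) =
    trans (cong ((a ℕ.+ b) ℕ.+_) (go u v))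
          (interchange a b (Vec.sum u) (Vec.sum v))

-- The value on [] is a placeholder: the gcd is only used for nonempty families.
gcds : List Monomial → Monomial
gcds []       = 1ᵐ
gcds (m ∷ ms) = List.foldr gcdᵐ m ms

degreeSum : List Monomial → ℕ
degreeSum = List.sum ∘ List.map deg

infix 8 _↾_
_↾_ : ∀ {a} {A : Set a} {n} → Vec A n → Subset n → List A
[]       ↾ []          = []
(x ∷ xs) ↾ (true ∷ J)  = x ∷ xs ↾ J
(x ∷ xs) ↾ (false ∷ J) = xs ↾ J

-- Semistability of the syzygy bundle of the monomial ideal with minimal
-- generators g, in the numerical form due to Brenner.  The instance argument
-- NonZero (∣ J ∣ ∸ 1) says that J has at least two elements.
SyzygyBundleSemistable : ∀ {t} (g : Vec Monomial t) .{{_ : NonZero (t ∸ 1)}} → Set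
SyzygyBundleSemistable {t} g =
  (J : Subset t) → J ⊂ ⊤ → .{{_ : NonZero (∣ J ∣ ∸ 1)}} →
  (+ deg (gcds (g ↾ J)) ℤ.- + degreeSum (g ↾ J)) / (∣ J ∣ ∸ 1)
    ℚ.≤ (ℤ.- + degreeSum (Vec.toList g)) / (t ∸ 1)

module _ {c ℓ₁ ℓ₂} (K : HeytingField c ℓ₁ ℓ₂) where

  private
    module K = HeytingField K
    open K using (Carrier; 0#; 1#)
    module KR = CommutativeRing
      (HeytingCommutativeRing.commutativeRing K.heytingCommutativeRing)
    open RawMonoidDefinitions KR.+-rawMonoid using () renaming (_×_ to _×ᴷ_)

  CharacteristicZero : Set ℓ₁
  CharacteristicZero = ∀ n → ¬ ((suc n ×ᴷ 1#) K.≈ 0#)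

  -- Elements of K[x,y,z] are represented by finite formal sums of terms; two
  -- sums are identified (_≈ᴾ_) when all their coefficients agree.
  Poly : Set c
  Poly = List (Carrier × Monomial)

  coeff : Poly → Monomial → Carrier
  coeff f m =
    List.foldr K._+_ 0# (List.map proj₁ (List.filter ((_≟ᵐ m) ∘ proj₂) f))

  infix 4 _≈ᴾ_
  _≈ᴾ_ : Rel Poly ℓ₁
  f ≈ᴾ h = ∀ m → coeff f m K.≈ coeff h m

  0ᴾ : Poly
  0ᴾ = []

  infixl 6 _+ᴾ_ _-ᴾ_
  infixl 7 _*ᴾ_

  _+ᴾ_ : Poly → Poly → Poly
  _+ᴾ_ = _++_

  -ᴾ_ : Poly → Poly
  -ᴾ_ = List.map (λ (a , u) → K.- a , u)

  _-ᴾ_ : Poly → Poly → Poly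
  f -ᴾ h = f +ᴾ (-ᴾ h)

  _*ᴾ_ : Poly → Poly → Poly
  _*ᴾ_ = List.cartesianProductWith (λ (a , u) (b , v) → a K.* b , u ·ᵐ v)

  mono : Monomial → Poly
  mono m = (1# , m) ∷ []

  -- The ideal generated by a family of polynomials.
  ⟨_⟩ : {S : Set} → (S → Poly) → Pred Poly (c ⊔ ℓ₁)
  ⟨_⟩ {S} p f =
    ∃ λ (hs : List (Poly × S)) →
      f ≈ᴾ List.foldr _+ᴾ_ 0ᴾ (List.map (λ (h , s) → h *ᴾ p s) hs)

  monomialIdeal : ∀ {t} → Vec Monomial t → Pred Poly (c ⊔ ℓ₁)
  monomialIdeal g = ⟨ mono ∘ lookup g ⟩

  -- No generator can be omitted; in particular the generators are distinct.
  AreMinimalGenerators : ∀ {t} → Vec Monomial t → Set (c ⊔ ℓ₁)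
  AreMinimalGenerators {t} g =
    ∀ i → ¬ ⟨ (λ ((j , _) : Σ (Fin t) (_≢ i)) → mono (lookup g j)) ⟩
              (mono (lookup g i))

  -- [R]_j: linear combinations of monomials of degree j.
  Form : ℕ → Set c
  Form j = Σ Poly (All (λ (_ , u) → deg u ≡ j))

  mulForm : ∀ {i j} → Form i → Form j → Form (i ℕ.+ j)
  mulForm (f , Hf) (h , Hh) =
    f *ᴾ h ,
    All.cartesianProductWith⁺ (setoid _) (setoid _) _ f h
      (λ {(_ , u)} {(_ , v)} p q →
        trans (deg-·ᵐ u v) (cong₂ ℕ._+_ (All.lookup Hf p) (All.lookup Hh q)))

  -- For an ideal I, the quotient R/I is Poly with the following equality; for
  -- homogeneous I, its component [R/I]_j is Form j with the induced equality.
  module _ (I : Pred Poly (c ⊔ ℓ₁)) where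

    infix 4 _≈ᴬ_
    _≈ᴬ_ : Rel Poly (c ⊔ ℓ₁)
    f ≈ᴬ h = I (f -ᴾ h)

    _≈ᶠ_ : ∀ {j} → Rel (Form j) (c ⊔ ℓ₁)
    _≈ᶠ_ = _≈ᴬ_ on proj₁

    record IsQuotientIdeal (P : Pred Poly (c ⊔ ℓ₁)) : Set (c ⊔ ℓ₁) where
      field
        resp     : ∀ {f h} → f ≈ᴬ h → P f → P h
        0-closed : P 0ᴾ
        +-closed : ∀ {f h} → P f → P h → P (f +ᴾ h)
        *-closed : ∀ r {f} → P f → P (r *ᴾ f)

    -- The descending chain condition on ideals of R/I, in the form "no
    -- infinite descending chain is strict": the form asking for an explicit
    -- index of stabilisation is not constructively available.
    QuotientIsArtinian : Set (lsuc (c ⊔ ℓ₁))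
    QuotientIsArtinian =
      (P : ℕ → Pred Poly (c ⊔ ℓ₁)) → (∀ n → IsQuotientIdeal (P n)) →
      (∀ n → P (suc n) ⊆ P n) → ¬ (∀ n → ¬ (P n ⊆ P (suc n)))

    -- Degrees j < 0 are omitted: there [R/I]_j = 0 and the map is injective.
    QuotientHasWLP : Set (c ⊔ ℓ₁)
    QuotientHasWLP =
      ∃ λ (ℓ : Form 1) → ∀ j →
        Injective (_≈ᶠ_ {j}) (_≈ᶠ_ {suc j}) (mulForm ℓ) ⊎
        StrictlySurjective (_≈ᶠ_ {suc j}) (mulForm {1} {j} ℓ)

{-# OPTIONS --safe #-}

-- For a monomial m let h(n) count the monomials of degree n that are divisible
-- by m and lie outside I: this is the Hilbert function of the ideal generated
-- by m in R/I.  By (iii) a monomial of degree below d is divisible by at most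
-- one generator, and inclusion-exclusion gives
--   h(d-1) - h(d-2) = max(0, d - deg m) - Σᵢ max(0, d - deg lcm(m, gᵢ)).
-- For m = 1 the right-hand side is d - Σᵢ (d - dᵢ) = 0, so multiplication by ℓ
-- from degree d-2 to degree d-1 is injective on R/I, hence on the ideal of m,
-- or surjective onto R/I, hence onto R/(I + (m)).  Either way
-- h(d-2) ≤ h(d-1).  Taking m to be the gcd of the generators in J, whose lcm
-- with m is themselves, yields Σ_J (d - d_j) ≤ d - deg m, which is Brenner's
-- inequality for J.

module Submission where

open import Defs
open import Algebra.Apartness.Bundles using (HeytingField)
open import Data.Integer.Base using (ℤ; +_)
open import Data.Nat.Base using (NonZero; _∸_)
open import Data.Product.Base using (∃)
open import Data.Rational.Base using (ℚ; _/_; _<_; _≤_)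
open import Data.Vec.Base using (Vec; lookup; toList)
open import Relation.Binary.PropositionalEquality using (_≡_; _≢_)

open import Algebra.Apartness.Bundles using (HeytingCommutativeRing)
import Algebra.Apartness.Properties.HeytingCommutativeRing as HeytingProperties
open import Algebra.Bundles using (CommutativeRing)
import Algebra.Properties.CommutativeSemigroup as SemigroupProperties
import Algebra.Properties.Ring as RingProperties
import Algebra.Properties.Semiring.Sum as SemiringSum
open import Data.Bool.Base using (true; false)
open import Data.Fin.Base using (Fin; zero; suc; punchIn)
import Data.Fin.Properties as Fin
open import Data.Fin.Subset using (∣_∣)
open import Data.Integer.Base as ℤ using (-[1+_])
import Data.Integer.Properties as ℤ
import Data.Integer.Tactic.RingSolver as ℤ
open import Data.List.Base as List using (List; []; _∷_; _++_; length; filter)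
open import Data.List.Membership.Propositional using (_∈_)
open import Data.List.Membership.Propositional.Properties
  using (∈-map⁺; ∈-map⁻; ∈-++⁺ˡ; ∈-++⁺ʳ; ∈-filter⁺; ∈-filter⁻; ∈-lookup)
import Data.List.Properties as List
open import Data.List.Relation.Unary.All as All using (All; []; _∷_)
import Data.List.Relation.Unary.All.Properties as All
import Data.List.Relation.Unary.AllPairs as AllPairs
import Data.List.Relation.Unary.Any as ListAny
open import Data.List.Relation.Unary.Any using (here; there)
import Data.List.Relation.Unary.Any.Properties as ListAny
open import Data.List.Relation.Unary.Unique.Propositional using (Unique)
import Data.List.Relation.Unary.Unique.Propositional.Properties as Unique
open import Data.Nat.Base
  using (ℕ; zero; suc; _⊔_; _⊓_; z≤n; s≤s; s≤s⁻¹)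
  renaming (_+_ to _+ⁿ_; _*_ to _*ⁿ_; _≤_ to _≤ⁿ_; _<_ to _<ⁿ_)
open import Data.Nat.ListAction using (sum)
import Data.Nat.Properties as ℕ
open import Data.Product.Base using (_×_; _,_; proj₁; proj₂)
import Data.Rational.Properties as ℚ
open import Data.Rational.Unnormalised.Base using (mkℚᵘ; *≡*; *≤*; *<*)
import Data.Rational.Unnormalised.Properties as ℚᵘ
open import Data.Sum.Base using (inj₁; inj₂)
open import Data.Vec.Base as Vec using ([]; _∷_)
import Data.Vec.Functional as Vector
import Data.Vec.Functional.Properties as Vector
import Data.Vec.Properties as Vec
open import Data.Vec.Relation.Binary.Pointwise.Inductive as Pointwise
  using (Pointwise; []; _∷_)
open import Data.Vec.Relation.Unary.Any as VecAny using (Any; any?; here; there)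
import Data.Vec.Relation.Unary.Any.Properties as VecAny
open import Function.Base using (_∘_)
open import Function.Definitions using (Injective; StrictlySurjective)
open import Level using (0ℓ)
open import Relation.Binary.Core using (Rel)
open import Relation.Binary.Definitions using (Decidable)
open import Relation.Binary.PropositionalEquality
  using (refl; sym; trans; cong; cong₂; subst; module ≡-Reasoning)
import Relation.Binary.Reasoning.Setoid as SetoidReasoning
open import Relation.Nullary using (¬_; Dec; yes; no; does; contradiction)
open import Relation.Unary as U using (Pred; ∁; _∩_)
open import Relation.Unary.Properties using (_∩?_; ∁?)
open SemigroupProperties ℕ.+-commutativeSemigroup using (interchange; xy∙z≈xz∙y)

-- Divisibility, lcm and gcd of exponent vectors.

infix 4 _∣ᵐ_ _∣ᵐ?_

_∣ᵐ_ : ∀ {k} → Rel (Vec ℕ k) 0ℓ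
_∣ᵐ_ = Pointwise _≤ⁿ_

_∣ᵐ?_ : ∀ {k} → Decidable (_∣ᵐ_ {k})
_∣ᵐ?_ = Pointwise.decidable ℕ._≤?_

∣ᵐ-refl : ∀ {k} {u : Vec ℕ k} → u ∣ᵐ u
∣ᵐ-refl = Pointwise.refl ℕ.≤-refl

∣ᵐ-trans : ∀ {k} {u v w : Vec ℕ k} → u ∣ᵐ v → v ∣ᵐ w → u ∣ᵐ w
∣ᵐ-trans = Pointwise.trans ℕ.≤-trans

1∣ᵐ : ∀ {k} (u : Vec ℕ k) → Vec.replicate k 0 ∣ᵐ u
1∣ᵐ []      = []
1∣ᵐ (a ∷ u) = z≤n ∷ 1∣ᵐ u

∣ᵐ⇒sum≤ : ∀ {k} {u v : Vec ℕ k} → u ∣ᵐ v → Vec.sum u ≤ⁿ Vec.sum v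
∣ᵐ⇒sum≤ []       = z≤n
∣ᵐ⇒sum≤ (p ∷ ps) = ℕ.+-mono-≤ p (∣ᵐ⇒sum≤ ps)

u∣ᵐv·u : ∀ {k} (v u : Vec ℕ k) → u ∣ᵐ Vec.zipWith _+ⁿ_ v u
u∣ᵐv·u []      []      = []
u∣ᵐv·u (b ∷ v) (a ∷ u) = ℕ.m≤n+m a b ∷ u∣ᵐv·u v u

quotient·divisor : ∀ {k} {u w : Vec ℕ k} → u ∣ᵐ w →
                   Vec.zipWith _+ⁿ_ (Vec.zipWith _∸_ w u) u ≡ w
quotient·divisor []       = refl
quotient·divisor (p ∷ ps) = cong₂ _∷_ (ℕ.m∸n+n≡m p) (quotient·divisor ps)

lcm-least : ∀ {k} {u v w : Vec ℕ k} → u ∣ᵐ w → v ∣ᵐ w → Vec.zipWith _⊔_ u v ∣ᵐ w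
lcm-least []       []       = []
lcm-least (p ∷ ps) (q ∷ qs) = ℕ.⊔-lub p q ∷ lcm-least ps qs

u∣ᵐlcm : ∀ {k} (u v : Vec ℕ k) → u ∣ᵐ Vec.zipWith _⊔_ u v
u∣ᵐlcm []      []      = []
u∣ᵐlcm (a ∷ u) (b ∷ v) = ℕ.m≤m⊔n a b ∷ u∣ᵐlcm u v

v∣ᵐlcm : ∀ {k} (u v : Vec ℕ k) → v ∣ᵐ Vec.zipWith _⊔_ u v
v∣ᵐlcm []      []      = []
v∣ᵐlcm (a ∷ u) (b ∷ v) = ℕ.m≤n⊔m a b ∷ v∣ᵐlcm u v

lcm-absorbs : ∀ {k} {u v : Vec ℕ k} → u ∣ᵐ v → Vec.zipWith _⊔_ u v ≡ v
lcm-absorbs []       = refl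
lcm-absorbs (p ∷ ps) = cong₂ _∷_ (ℕ.m≤n⇒m⊔n≡n p) (lcm-absorbs ps)

sum-lcm≤ : ∀ {k} (u v : Vec ℕ k) →
           Vec.sum (Vec.zipWith _⊔_ u v) ≤ⁿ Vec.sum u +ⁿ Vec.sum v
sum-lcm≤ []      []      = z≤n
sum-lcm≤ (a ∷ u) (b ∷ v) = ℕ.≤-trans
  (ℕ.+-mono-≤ (ℕ.m⊔n≤m+n a b) (sum-lcm≤ u v))
  (ℕ.≤-reflexive (interchange a b (Vec.sum u) (Vec.sum v)))

gcd∣ᵐˡ : ∀ {k} (u v : Vec ℕ k) → Vec.zipWith _⊓_ u v ∣ᵐ u
gcd∣ᵐˡ []      []      = []
gcd∣ᵐˡ (a ∷ u) (b ∷ v) = ℕ.m⊓n≤m a b ∷ gcd∣ᵐˡ u v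

gcd∣ᵐʳ : ∀ {k} (u v : Vec ℕ k) → Vec.zipWith _⊓_ u v ∣ᵐ v
gcd∣ᵐʳ []      []      = []
gcd∣ᵐʳ (a ∷ u) (b ∷ v) = ℕ.m⊓n≤n a b ∷ gcd∣ᵐʳ u v

-- The fold in `gcds` is seeded with the first monomial, which ends up innermost, so `∣-init` treats
-- it apart from the others.
gcds-divides : ∀ ms → All (gcds ms ∣ᵐ_) ms
gcds-divides []       = []
gcds-divides (m ∷ ms) = ∣-init ms ∷ ∣-tail ms
  where
  ∣-init : ∀ ms → List.foldr gcdᵐ m ms ∣ᵐ m
  ∣-init []       = ∣ᵐ-refl
  ∣-init (n ∷ ms) = ∣ᵐ-trans (gcd∣ᵐʳ n _) (∣-init ms)

  ∣-tail : ∀ ms → All (List.foldr gcdᵐ m ms ∣ᵐ_) ms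
  ∣-tail []       = []
  ∣-tail (n ∷ ms) = gcd∣ᵐˡ n _ ∷ All.map (∣ᵐ-trans (gcd∣ᵐʳ n _)) (∣-tail ms)

-- Enumeration of the monomials of a given degree.

incHead : ∀ {k} → Vec ℕ (suc k) → Vec ℕ (suc k)
incHead (a ∷ u) = suc a ∷ u

-- A monomial of positive degree either omits the first variable or is that variable times a
-- monomial of one degree less. The number of variables is arbitrary because the recursion lowers
-- it.
monomials : ∀ k → ℕ → List (Vec ℕ k)
monomials zero    zero    = [] ∷ []
monomials zero    (suc n) = []
monomials (suc k) zero    = List.map (0 ∷_) (monomials k zero)
monomials (suc k) (suc n) =
  List.map (0 ∷_) (monomials k (suc n)) ++ List.map incHead (monomials (suc k) n)

∈-monomials⁺ : ∀ {k n} (u : Vec ℕ k) → Vec.sum u ≡ n → u ∈ monomials k n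
∈-monomials⁺ {n = zero}  []          eq = here refl
∈-monomials⁺ {n = zero}  (zero ∷ u)  eq = ∈-map⁺ (0 ∷_) (∈-monomials⁺ u eq)
∈-monomials⁺ {n = suc n} (zero ∷ u)  eq =
  ∈-++⁺ˡ (∈-map⁺ (0 ∷_) (∈-monomials⁺ u eq))
∈-monomials⁺ {n = suc n} (suc a ∷ u) eq =
  ∈-++⁺ʳ _ (∈-map⁺ incHead (∈-monomials⁺ (a ∷ u) (ℕ.suc-injective eq)))

monomials-sum : ∀ k n → All (λ u → Vec.sum u ≡ n) (monomials k n)
monomials-sum zero    zero    = refl ∷ []
monomials-sum zero    (suc n) = []
monomials-sum (suc k) zero    = All.map⁺ (monomials-sum k zero)
monomials-sum (suc k) (suc n) = All.++⁺
  (All.map⁺ (monomials-sum k (suc n)))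
  (All.map⁺ (All.map (λ { {_ ∷ _} eq → cong suc eq }) (monomials-sum (suc k) n)))

-- Ensures that distinct positions in the list later index distinct basis elements.
monomials-unique : ∀ k n → Unique (monomials k n)
monomials-unique zero    zero    = [] AllPairs.∷ AllPairs.[]
monomials-unique zero    (suc n) = AllPairs.[]
monomials-unique (suc k) zero    =
  Unique.map⁺ Vec.∷-injectiveʳ (monomials-unique k zero)
monomials-unique (suc k) (suc n) = Unique.++⁺
  (Unique.map⁺ Vec.∷-injectiveʳ (monomials-unique k (suc n)))
  (Unique.map⁺ incHead-injective (monomials-unique (suc k) n))
  λ (p , q) → heads-differ (∈-map⁻ (0 ∷_) p) (∈-map⁻ incHead q)
  where
  incHead-injective : ∀ {u v : Vec ℕ (suc k)} → incHead u ≡ incHead v → u ≡ v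
  incHead-injective {_ ∷ _} {_ ∷ _} refl = refl

  heads-differ : ∀ {u : Vec ℕ (suc k)} {us vs} →
                 (∃ λ v → v ∈ us × u ≡ 0 ∷ v) → ¬ (∃ λ v → v ∈ vs × u ≡ incHead v)
  heads-differ (_ , _ , refl) (_ ∷ _ , _ , ())

-- Counting the elements of a list with a decidable property.

module _ {a p} {A : Set a} {P : Pred A p} (P? : U.Decidable P) where

  count : List A → ℕ
  count = length ∘ filter P?

  count-++ : ∀ xs ys → count (xs ++ ys) ≡ count xs +ⁿ count ys
  count-++ xs ys = trans (cong length (List.filter-++ P? xs ys))
                         (List.length-++ (filter P? xs))

  count-map : ∀ {b} {B : Set b} (f : B → A) (xs : List B) →
              count (List.map f xs) ≡ length (filter (P? ∘ f) xs)
  count-map f []       = refl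
  count-map f (x ∷ xs) with ih ← count-map f xs | does (P? (f x))
  ... | true  = cong suc ih
  ... | false = ih

  count-none : ∀ {xs} → All (∁ P) xs → count xs ≡ 0
  count-none = cong length ∘ List.filter-none P?

  count-cong : ∀ {q} {Q : Pred A q} (Q? : U.Decidable Q) xs →
               (∀ {x} → x ∈ xs → P x → Q x) → (∀ {x} → x ∈ xs → Q x → P x) →
               count xs ≡ length (filter Q? xs)
  count-cong Q? []       P⇒Q Q⇒P = refl
  count-cong Q? (x ∷ xs) P⇒Q Q⇒P
    with ih ← count-cong Q? xs (P⇒Q ∘ there) (Q⇒P ∘ there) | P? x | Q? x
  ... | yes px | yes qx = cong suc ih
  ... | yes px | no ¬qx = contradiction (P⇒Q (here refl) px) ¬qx
  ... | no ¬px | yes qx = contradiction (Q⇒P (here refl) qx) ¬px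
  ... | no ¬px | no ¬qx = ih

  count-split : ∀ {q} {Q : Pred A q} (Q? : U.Decidable Q) xs →
                count xs ≡ length (filter (P? ∩? Q?) xs) +ⁿ length (filter (P? ∩? ∁? Q?) xs)
  count-split Q? []       = refl
  count-split Q? (x ∷ xs) with ih ← count-split Q? xs | does (P? x) | does (Q? x)
  ... | true  | true  = cong suc ih
  ... | true  | false = trans (cong suc ih) (sym (ℕ.+-suc _ _))
  ... | false | _     = ih

-- Numbers of multiples of a monomial in a given degree.

numMultiples : ∀ {k} → Vec ℕ k → ℕ → ℕ
numMultiples []          zero    = 1
numMultiples []          (suc n) = 0
numMultiples (zero ∷ w)  zero    = numMultiples w zero
numMultiples (zero ∷ w)  (suc n) = numMultiples w (suc n) +ⁿ numMultiples (0 ∷ w) n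
numMultiples (suc a ∷ w) zero    = 0
numMultiples (suc a ∷ w) (suc n) = numMultiples (a ∷ w) n

module _ {k} (us : List (Vec ℕ k)) where

  count-0∷ : ∀ w → count ((0 ∷ w) ∣ᵐ?_) (List.map (0 ∷_) us) ≡ count (w ∣ᵐ?_) us
  count-0∷ w = trans (count-map ((0 ∷ w) ∣ᵐ?_) (0 ∷_) us)
    (count-cong _ (w ∣ᵐ?_) us (λ _ → Pointwise.tail) (λ _ → z≤n ∷_))

  count-suc∷ : ∀ a w → count ((suc a ∷ w) ∣ᵐ?_) (List.map (0 ∷_) us) ≡ 0
  count-suc∷ a w = count-none _ (All.map⁺ (All.universal (λ { u (() ∷ _) }) us))

module _ {k} (us : List (Vec ℕ (suc k))) where

  count-incHead-0∷ : ∀ w → count ((0 ∷ w) ∣ᵐ?_) (List.map incHead us) ≡ count ((0 ∷ w) ∣ᵐ?_) us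
  count-incHead-0∷ w = trans (count-map ((0 ∷ w) ∣ᵐ?_) incHead us)
    (count-cong _ ((0 ∷ w) ∣ᵐ?_) us
      (λ { {_ ∷ _} _ (_ ∷ ps) → z≤n ∷ ps }) (λ { {_ ∷ _} _ (_ ∷ ps) → z≤n ∷ ps }))

  count-incHead-suc∷ : ∀ a w →
    count ((suc a ∷ w) ∣ᵐ?_) (List.map incHead us) ≡ count ((a ∷ w) ∣ᵐ?_) us
  count-incHead-suc∷ a w = trans (count-map ((suc a ∷ w) ∣ᵐ?_) incHead us)
    (count-cong _ ((a ∷ w) ∣ᵐ?_) us
      (λ { {_ ∷ _} _ (s≤s p ∷ ps) → p ∷ ps }) (λ { {_ ∷ _} _ (p ∷ ps) → s≤s p ∷ ps }))

-- `numMultiples` follows the recursion of `monomials`. A positive first exponent leaves only the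
-- half of the enumeration that involves the first variable, and there one factor of that variable
-- is divided out.
count-multiples : ∀ {k} (w : Vec ℕ k) n →
                  count (w ∣ᵐ?_) (monomials k n) ≡ numMultiples w n
count-multiples []          zero    = refl
count-multiples []          (suc n) = refl
count-multiples (zero ∷ w)  zero    =
  trans (count-0∷ (monomials _ zero) w) (count-multiples w zero)
count-multiples (suc a ∷ w) zero    = count-suc∷ (monomials _ zero) a w
count-multiples (zero ∷ w)  (suc n) = trans
  (count-++ ((0 ∷ w) ∣ᵐ?_) (List.map (0 ∷_) (monomials _ (suc n))) _)
  (cong₂ _+ⁿ_
    (trans (count-0∷ (monomials _ (suc n)) w) (count-multiples w (suc n)))
    (trans (count-incHead-0∷ (monomials _ n) w) (count-multiples (0 ∷ w) n)))
count-multiples (suc a ∷ w) (suc n) = trans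
  (count-++ ((suc a ∷ w) ∣ᵐ?_) (List.map (0 ∷_) (monomials _ (suc n))) _)
  (cong₂ _+ⁿ_
    (count-suc∷ (monomials _ (suc n)) a w)
    (trans (count-incHead-suc∷ (monomials _ n) a w) (count-multiples (a ∷ w) n)))

-- numMultiples (b ∷ []) n is 1 if b ≤ n and 0 otherwise.
numMultiples₁ : ∀ b n → numMultiples (b ∷ []) n +ⁿ (n ∸ b) ≡ suc n ∸ b
numMultiples₁ zero    zero    = refl
numMultiples₁ zero    (suc n) = trans (ℕ.+-suc _ n) (cong suc (numMultiples₁ zero n))
numMultiples₁ (suc b) zero    = sym (ℕ.0∸n≡0 b)
numMultiples₁ (suc b) (suc n) = numMultiples₁ b n

-- Peeling off the first variable leaves a sum of one-variable counts, each 0 or 1. Truncation gives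
-- the correct value 0 when `n` is below the degree of `w`.
numMultiples₂ : ∀ (w : Vec ℕ 2) n → numMultiples w n ≡ suc n ∸ Vec.sum w
numMultiples₂ (zero ∷ b ∷ [])  zero    =
  trans (sym (trans (cong (numMultiples (b ∷ []) 0 +ⁿ_) (ℕ.0∸n≡0 b)) (ℕ.+-identityʳ _)))
        (trans (numMultiples₁ b zero) (cong (1 ∸_) (sym (ℕ.+-identityʳ b))))
numMultiples₂ (zero ∷ b ∷ [])  (suc n) =
  trans (cong (numMultiples (b ∷ []) (suc n) +ⁿ_)
          (trans (numMultiples₂ (0 ∷ b ∷ []) n) (cong (suc n ∸_) (ℕ.+-identityʳ b))))
        (trans (numMultiples₁ b (suc n)) (cong (suc (suc n) ∸_) (sym (ℕ.+-identityʳ b))))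
numMultiples₂ (suc a ∷ w)      zero    = sym (ℕ.0∸n≡0 (a +ⁿ Vec.sum w))
numMultiples₂ (suc a ∷ w)      (suc n) = numMultiples₂ (a ∷ w) n

numMultiples-0 : ∀ {k} (w : Vec ℕ k) → numMultiples w 0 ≡ 1 ∸ Vec.sum w
numMultiples-0 []          = refl
numMultiples-0 (zero ∷ w)  = numMultiples-0 w
numMultiples-0 (suc a ∷ w) = sym (ℕ.0∸n≡0 (a +ⁿ Vec.sum w))

-- If `w` omits the first variable, multiplication by that variable embeds its multiples of degree
-- `n` into those of degree `n + 1`, and what is missed is a two-variable count. A positive first
-- exponent is lowered together with the degree by dividing out the variable.
numMultiples₃ : ∀ (w : Vec ℕ 3) n →
                numMultiples w (suc n) ≡ numMultiples w n +ⁿ (suc (suc n) ∸ Vec.sum w)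
numMultiples₃ (zero ∷ w)  n       = trans
  (cong (_+ⁿ numMultiples (0 ∷ w) n) (numMultiples₂ w (suc n)))
  (ℕ.+-comm _ (numMultiples (0 ∷ w) n))
numMultiples₃ (suc a ∷ w) zero    = numMultiples-0 (a ∷ w)
numMultiples₃ (suc a ∷ w) (suc n) = numMultiples₃ (a ∷ w) n

-- Standard monomials and inclusion-exclusion.

infix 4 _∈⟨_⟩ _∈⟨_⟩?

_∈⟨_⟩ : ∀ {k t} → Vec ℕ k → Vec (Vec ℕ k) t → Set
u ∈⟨ gs ⟩ = Any (_∣ᵐ u) gs

_∈⟨_⟩? : ∀ {k t} (u : Vec ℕ k) (gs : Vec (Vec ℕ k) t) → Dec (u ∈⟨ gs ⟩)
u ∈⟨ gs ⟩? = any? (_∣ᵐ? u) gs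

Standard : ∀ {k t} → Vec ℕ k → Vec (Vec ℕ k) t → Pred (Vec ℕ k) 0ℓ
Standard m gs = (m ∣ᵐ_) ∩ ∁ (_∈⟨ gs ⟩)

standard? : ∀ {k t} (m : Vec ℕ k) (gs : Vec (Vec ℕ k) t) → U.Decidable (Standard m gs)
standard? m gs = (m ∣ᵐ?_) ∩? ∁? (_∈⟨ gs ⟩?)

-- The form in which condition (iii) enters the counting: inclusion-exclusion stops after its
-- first-order terms.
Separates : ∀ {k t} → Vec (Vec ℕ k) t → List (Vec ℕ k) → Set
Separates gs us = ∀ {u} → u ∈ us → ∀ i j → i ≢ j →
                  ¬ (lookup gs i ∣ᵐ u × lookup gs j ∣ᵐ u)

-- Induction on the generators: adjoining `h` removes exactly the multiples of `h` among the
-- standard monomials, and by separation these are all the multiples of the lcm of `m` and `h` in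
-- the list.
count-standard : ∀ {k t} (m : Vec ℕ k) (gs : Vec (Vec ℕ k) t) us → Separates gs us →
  count (m ∣ᵐ?_) us ≡
  count (standard? m gs) us +ⁿ
    sum (List.map (λ h → count (Vec.zipWith _⊔_ m h ∣ᵐ?_) us) (toList gs))
count-standard m []       us sep = trans
  (count-cong (m ∣ᵐ?_) (standard? m []) us (λ _ p → p , λ ()) (λ _ → proj₁))
  (sym (ℕ.+-identityʳ _))
count-standard m (h ∷ gs) us sep = begin
  count (m ∣ᵐ?_) us
    ≡⟨ count-standard m gs us (λ p i j i≢j → sep p (suc i) (suc j) (i≢j ∘ Fin.suc-injective)) ⟩
  count (standard? m gs) us +ⁿ rest
    ≡⟨ cong (_+ⁿ rest) (count-split (standard? m gs) (h ∣ᵐ?_) us) ⟩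
  count (standard? m gs ∩? (h ∣ᵐ?_)) us +ⁿ count (standard? m gs ∩? ∁? (h ∣ᵐ?_)) us +ⁿ rest
    ≡⟨ cong (_+ⁿ rest) (cong₂ _+ⁿ_
         (count-cong _ (Vec.zipWith _⊔_ m h ∣ᵐ?_) us
           (λ _ ((m∣u , _) , h∣u) → lcm-least m∣u h∣u)
           -- A multiple of the lcm is divisible by `h`, hence by no generator in `gs`, so it is
           -- still standard for `gs`.
           (λ p l∣u → (∣ᵐ-trans (u∣ᵐlcm m h) l∣u , not-in p (∣ᵐ-trans (v∣ᵐlcm m h) l∣u)) ,
                      ∣ᵐ-trans (v∣ᵐlcm m h) l∣u))
         (count-cong _ (standard? m (h ∷ gs)) us
           (λ _ ((m∣u , u∉) , h∤u) → m∣u , λ { (here h∣u) → h∤u h∣u ; (there u∈) → u∉ u∈ })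
           (λ _ (m∣u , u∉) → (m∣u , u∉ ∘ there) , u∉ ∘ here))) ⟩
  first +ⁿ count (standard? m (h ∷ gs)) us +ⁿ rest
    ≡⟨ cong (_+ⁿ rest) (ℕ.+-comm first _) ⟩
  count (standard? m (h ∷ gs)) us +ⁿ first +ⁿ rest
    ≡⟨ ℕ.+-assoc _ first rest ⟩
  count (standard? m (h ∷ gs)) us +ⁿ (first +ⁿ rest) ∎
  where
  open ≡-Reasoning
  first = count (Vec.zipWith _⊔_ m h ∣ᵐ?_) us
  rest  = sum (List.map (λ h → count (Vec.zipWith _⊔_ m h ∣ᵐ?_) us) (toList gs))

  not-in : ∀ {u} → u ∈ us → h ∣ᵐ u → ¬ u ∈⟨ gs ⟩
  not-in p h∣u u∈ = sep p zero (suc (VecAny.index u∈)) (λ ()) (h∣u , VecAny.lookup-index u∈)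

-- The dimension of the degree n component of the ideal of m in R/I.
hilbert : ∀ {t} → Monomial → Vec Monomial t → ℕ → ℕ
hilbert m gs n = count (standard? m gs) (monomials 3 n)

-- The inclusion-exclusion formula for h(n+1) - h(n), with d = n + 2, arranged so
-- that truncated subtraction only occurs where it is intended.
hilbert-step : ∀ {t} m (gs : Vec Monomial t) n →
  (∀ i j → i ≢ j → suc (suc n) ≤ⁿ deg (lcmᵐ (lookup gs i) (lookup gs j))) →
  hilbert m gs (suc n) +ⁿ sum (List.map (λ h → suc (suc n) ∸ deg (lcmᵐ m h)) (toList gs)) ≡
  hilbert m gs n +ⁿ (suc (suc n) ∸ deg m)
-- `S n` is the first-order correction in degree `n`. Adding it turns both sides into counts of all
-- multiples of `m`, whose growth is known; afterwards it is cancelled.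
hilbert-step m gs n big = ℕ.+-cancelʳ-≡ (S n) _ _ (begin
  hilbert m gs (suc n) +ⁿ Δ +ⁿ S n     ≡⟨ ℕ.+-assoc _ Δ (S n) ⟩
  hilbert m gs (suc n) +ⁿ (Δ +ⁿ S n)   ≡⟨ cong (hilbert m gs (suc n) +ⁿ_) (S-step (toList gs)) ⟨
  hilbert m gs (suc n) +ⁿ S (suc n)    ≡⟨ total (suc n) ℕ.≤-refl ⟨
  numMultiples m (suc n)               ≡⟨ numMultiples₃ m n ⟩
  numMultiples m n +ⁿ (D ∸ deg m)      ≡⟨ cong (_+ⁿ (D ∸ deg m)) (total n (ℕ.n≤1+n _)) ⟩
  hilbert m gs n +ⁿ S n +ⁿ (D ∸ deg m) ≡⟨ xy∙z≈xz∙y (hilbert m gs n) (S n) _ ⟩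
  hilbert m gs n +ⁿ (D ∸ deg m) +ⁿ S n ∎)
  where
  open ≡-Reasoning
  D = suc (suc n)
  S : ℕ → ℕ
  S n = sum (List.map (λ h → numMultiples (lcmᵐ m h) n) (toList gs))
  Δ = sum (List.map (λ h → D ∸ deg (lcmᵐ m h)) (toList gs))

  S-step : ∀ hs → sum (List.map (λ h → numMultiples (lcmᵐ m h) (suc n)) hs) ≡
                  sum (List.map (λ h → D ∸ deg (lcmᵐ m h)) hs) +ⁿ
                  sum (List.map (λ h → numMultiples (lcmᵐ m h) n) hs)
  S-step []       = refl
  S-step (h ∷ hs) = trans
    (cong₂ _+ⁿ_
      (trans (numMultiples₃ (lcmᵐ m h) n) (ℕ.+-comm (numMultiples (lcmᵐ m h) n) _))
      (S-step hs))
    (interchange (D ∸ deg (lcmᵐ m h)) (numMultiples (lcmᵐ m h) n) _ _)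

  -- Two generators dividing a monomial of degree `j` would have an lcm of degree at most `j`,
  -- against `big` because `j` is below `D`. So `count-standard` applies.
  total : ∀ j → suc j ≤ⁿ D → numMultiples m j ≡ hilbert m gs j +ⁿ S j
  total j j<D = trans (sym (count-multiples m j)) (trans
    (count-standard m gs (monomials 3 j)
      (λ {u} p i i′ i≢i′ (q , q′) → ℕ.<⇒≱ j<D (ℕ.≤-trans (big i i′ i≢i′)
        (ℕ.≤-trans (∣ᵐ⇒sum≤ (lcm-least q q′))
          (ℕ.≤-reflexive (All.lookup (monomials-sum 3 j) p))))))
    (cong (λ xs → hilbert m gs j +ⁿ sum xs)
      (List.map-cong (λ h → count-multiples (lcmᵐ m h) j) (toList gs))))

-- Standard monomials as an ordered basis.

standards : ∀ {t} → Monomial → Vec Monomial t → ℕ → List Monomial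
standards m g n = filter (standard? m g) (monomials 3 n)

∈-standards⁺ : ∀ {t} m (g : Vec Monomial t) {n u} →
               deg u ≡ n → Standard m g u → u ∈ standards m g n
∈-standards⁺ m g {u = u} eq std = ∈-filter⁺ (standard? m g) (∈-monomials⁺ u eq) std

module _ {t} m (g : Vec Monomial t) n (i : Fin (length (standards m g n))) where

  standards-standard : Standard m g (List.lookup (standards m g n) i)
  standards-standard =
    proj₂ (∈-filter⁻ (standard? m g) {xs = monomials 3 n} (∈-lookup i))

  standards-deg : deg (List.lookup (standards m g n) i) ≡ n
  standards-deg = All.lookup (monomials-sum 3 n)
    (proj₁ (∈-filter⁻ (standard? m g) (∈-lookup i)))

lookup-unique : ∀ {a} {A : Set a} {xs : List A} → Unique xs →
                ∀ i j → i ≢ j → List.lookup xs i ≢ List.lookup xs j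
lookup-unique (x∉ AllPairs.∷ u) zero    zero    i≢j eq = i≢j refl
lookup-unique (x∉ AllPairs.∷ u) zero    (suc j) i≢j eq = All.lookup x∉ (∈-lookup j) eq
lookup-unique (x∉ AllPairs.∷ u) (suc i) zero    i≢j eq = All.lookup x∉ (∈-lookup i) (sym eq)
lookup-unique (x∉ AllPairs.∷ u) (suc i) (suc j) i≢j eq =
  lookup-unique u i j (i≢j ∘ cong suc) eq

standards-distinct : ∀ {t} m (g : Vec Monomial t) n i j → i ≢ j →
  List.lookup (standards m g n) i ≢ List.lookup (standards m g n) j
standards-distinct m g n =
  lookup-unique (Unique.filter⁺ (standard? m g) (monomials-unique 3 n))

-- Additivity along 0 → (m) → R/I → R/(I + (m)) → 0.
hilbert-quotient : ∀ {t} m (g : Vec Monomial t) n →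
                   hilbert 1ᵐ g n ≡ hilbert m g n +ⁿ hilbert 1ᵐ (m ∷ g) n
hilbert-quotient m g n = trans
  (count-split (standard? 1ᵐ g) (m ∣ᵐ?_) (monomials 3 n))
  (cong₂ _+ⁿ_
    (count-cong _ (standard? m g) (monomials 3 n)
      (λ _ ((_ , u∉) , m∣u) → m∣u , u∉)
      (λ _ (m∣u , u∉) → (1∣ᵐ _ , u∉) , m∣u))
    (count-cong _ (standard? 1ᵐ (m ∷ g)) (monomials 3 n)
      (λ _ ((_ , u∉) , m∤u) → 1∣ᵐ _ , λ { (here m∣u) → m∤u m∣u ; (there u∈) → u∉ u∈ })
      (λ _ (_ , u∉) → (1∣ᵐ _ , u∉ ∘ there) , u∉ ∘ here)))

-- Kernel vectors of matrices over a Heyting field.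

module _ {c ℓ₁ ℓ₂} (K : HeytingField c ℓ₁ ℓ₂) where

  open HeytingField K hiding (zero)
    renaming (refl to ≈-refl; sym to ≈-sym; trans to ≈-trans; reflexive to ≈-reflexive)
  open CommutativeRing (HeytingCommutativeRing.commutativeRing heytingCommutativeRing)
    using (semiring; ring; +-commutativeSemigroup; *-commutativeSemigroup)
  open HeytingProperties heytingCommutativeRing using (1#0; x-0≈x; #-congʳ)
  open RingProperties ring
    using (-‿distribˡ-*; -‿+-comm; -0#≈0#) renaming (x∙y⁻¹≈ε⇒x≈y to x-y≈0⇒x≈y)
  open SemiringSum semiring renaming (sum to sumᴷ)
  open SemigroupProperties +-commutativeSemigroup
    using () renaming (interchange to +-interchange)
  open SemigroupProperties *-commutativeSemigroup using (x∙yz≈y∙xz)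
  open SetoidReasoning setoid

  Nontrivial : ∀ {n} → (Fin n → Carrier) → Set ℓ₂
  Nontrivial x = ∃ λ i → x i # 0#

  LeftKernel : ∀ {a b} → (Fin a → Fin b → Carrier) → (Fin a → Carrier) → Set ℓ₁
  LeftKernel M x = ∀ j → sumᴷ (λ i → x i * M i j) ≈ 0#

  x#0⇒invertible : ∀ {x} → x # 0# → ∃ λ y → y * x ≈ 1#
  x#0⇒invertible {x} x#0 with y , yx≈1 , _ ← #⇒invertible x#0 =
    y , ≈-trans (*-congˡ (≈-sym (x-0≈x x))) yx≈1

  sum-zero : ∀ {n} (f : Fin n → Carrier) → (∀ i → f i ≈ 0#) → sumᴷ f ≈ 0#
  sum-zero {n} f f≈0 = ≈-trans (sum-cong-≋ f≈0) (sum-replicate-zero n)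

  -- Gaussian elimination, in the double-negation monad because apartness from
  -- 0 is not decidable.
  ∃-leftKernel : ∀ {a b} → b <ⁿ a → (M : Fin a → Fin b → Carrier) →
                 ¬ ¬ (∃ λ x → Nontrivial x × LeftKernel M x)
  ∃-leftKernel {suc a} {zero}  _   M none = none ((λ _ → 1#) , (zero , 1#0) , λ ())
  -- `pivot` refutes that any entry of the first column is apart from 0. Tightness then makes that
  -- column zero, which `no-pivot` refutes.
  ∃-leftKernel {suc a} {suc b} b<a M none = no-pivot (λ i → tight⇒ (pivot i))
    where
    tight⇒ : ∀ {x y} → ¬ x # y → x ≈ y
    tight⇒ = proj₁ (tight _ _)

    no-pivot : ¬ (∀ i → M i zero ≈ 0#)
    no-pivot column≈0 =
      ∃-leftKernel (ℕ.<-trans (ℕ.n<1+n b) b<a) (λ i j → M i (suc j))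
        λ { (x , x#0 , xM≈0) → none (x , x#0 , λ
              { zero    → sum-zero _ (λ i → ≈-trans (*-congˡ (column≈0 i)) (zeroʳ (x i)))
              ; (suc j) → xM≈0 j }) }

    pivot : ∀ p → ¬ M p zero # 0#
    pivot p Mp#0 = ∃-leftKernel (s≤s⁻¹ b<a) M′ λ { (x , x#0 , xM′≈0) →
      none (extend x , extend-# x x#0 , extend-kernel x xM′≈0) }
      where
      y : Carrier
      y = proj₁ (x#0⇒invertible Mp#0)

      yM≈1 : y * M p zero ≈ 1#
      yM≈1 = proj₂ (x#0⇒invertible Mp#0)

      s : Fin a → Carrier
      s i = - (M (punchIn p i) zero * y)

      M′ : Fin a → Fin b → Carrier
      M′ i j = M (punchIn p i) (suc j) + s i * M p (suc j)

      -- Reduced row `i` is row `punchIn p i` plus `s i` times row `p`, so a combination of reduced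
      -- rows gives the pivot row the total weight inserted here.
      extend : (Fin a → Carrier) → Fin (suc a) → Carrier
      extend x = Vector.insertAt x p (sumᴷ (λ i → x i * s i))

      extend-# : ∀ x → Nontrivial x → Nontrivial (extend x)
      extend-# x (i , xi#0) = punchIn p i ,
        #-congʳ (≈-sym (≈-reflexive (Vector.insertAt-punchIn x p _ i))) xi#0

      extend-sum : ∀ x (f : Fin (suc a) → Carrier) →
        sumᴷ (λ i → extend x i * f i) ≈
        sumᴷ (λ i → x i * (f (punchIn p i) + s i * f p))
      extend-sum x f = begin
        sumᴷ (λ i → extend x i * f i)
          ≈⟨ sum-remove {i = p} (λ i → extend x i * f i) ⟩
        extend x p * f p + sumᴷ (λ i → extend x (punchIn p i) * f (punchIn p i))
          ≈⟨ +-cong (*-congʳ (≈-reflexive (Vector.insertAt-lookup x p _)))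
                    (sum-cong-≋ (λ i → *-congʳ (≈-reflexive (Vector.insertAt-punchIn x p _ i)))) ⟩
        sumᴷ (λ i → x i * s i) * f p + sumᴷ (λ i → x i * f (punchIn p i))
          ≈⟨ +-comm _ _ ⟩
        sumᴷ (λ i → x i * f (punchIn p i)) + sumᴷ (λ i → x i * s i) * f p
          ≈⟨ +-congˡ (*-distribʳ-sum (f p) (λ i → x i * s i)) ⟩
        sumᴷ (λ i → x i * f (punchIn p i)) + sumᴷ (λ i → x i * s i * f p)
          ≈⟨ ∑-distrib-+ (λ i → x i * f (punchIn p i)) (λ i → x i * s i * f p) ⟨
        sumᴷ (λ i → x i * f (punchIn p i) + x i * s i * f p)
          ≈⟨ sum-cong-≋ (λ i → ≈-trans (+-congˡ (*-assoc _ _ _)) (≈-sym (distribˡ (x i) _ _))) ⟩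
        sumᴷ (λ i → x i * (f (punchIn p i) + s i * f p)) ∎

      eliminated : ∀ i → M (punchIn p i) zero + s i * M p zero ≈ 0#
      eliminated i = begin
        v + - (v * y) * M p zero   ≈⟨ +-congˡ (-‿distribˡ-* (v * y) (M p zero)) ⟨
        v + - (v * y * M p zero)   ≈⟨ +-congˡ (-‿cong (*-assoc v y (M p zero))) ⟩
        v + - (v * (y * M p zero)) ≈⟨ +-congˡ (-‿cong (*-congˡ yM≈1)) ⟩
        v + - (v * 1#)             ≈⟨ +-congˡ (-‿cong (*-identityʳ v)) ⟩
        v + - v                    ≈⟨ -‿inverseʳ v ⟩
        0#                         ∎
        where v = M (punchIn p i) zero

      extend-kernel : ∀ x → LeftKernel M′ x → LeftKernel M (extend x)
      extend-kernel x xM′≈0 zero    = ≈-trans (extend-sum x (λ i → M i zero))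
        (sum-zero _ λ i → ≈-trans (*-congˡ (eliminated i)) (zeroʳ (x i)))
      extend-kernel x xM′≈0 (suc j) = ≈-trans (extend-sum x (λ i → M i (suc j))) (xM′≈0 j)

  -- Coefficients of sums and products.

  private
    Polyᴷ = Poly K
    coeffᴷ = coeff K
    monoᴷ = mono K
    infixl 7 _*ᴾᴷ_
    _*ᴾᴷ_ = _*ᴾ_ K

  sum-only : ∀ {n} (f : Fin n → Carrier) i → (∀ j → j ≢ i → f j ≈ 0#) → sumᴷ f ≈ f i
  sum-only {suc n} f i f≈0 = begin
    sumᴷ f                               ≈⟨ sum-remove {i = i} f ⟩
    f i + sumᴷ (λ j → f (punchIn i j))   ≈⟨ +-congˡ (sum-zero _ (λ j → f≈0 _ (Fin.punchInᵢ≢i i j))) ⟩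
    f i + 0#                             ≈⟨ +-identityʳ (f i) ⟩
    f i                                  ∎

  coeff-++ : ∀ f h w → coeffᴷ (f ++ h) w ≈ coeffᴷ f w + coeffᴷ h w
  coeff-++ []            h w = ≈-sym (+-identityˡ _)
  coeff-++ ((a , u) ∷ f) h w with does (u ≟ᵐ w)
  ... | true  = ≈-trans (+-congˡ (coeff-++ f h w)) (≈-sym (+-assoc _ _ _))
  ... | false = coeff-++ f h w

  coeff-neg : ∀ f w → coeffᴷ (-ᴾ_ K f) w ≈ - coeffᴷ f w
  coeff-neg []            w = ≈-sym -0#≈0#
  coeff-neg ((a , u) ∷ f) w with does (u ≟ᵐ w)
  ... | true  = ≈-trans (+-congˡ (coeff-neg f w)) (-‿+-comm _ _)
  ... | false = coeff-neg f w

  coeff-absent : ∀ {f w} → All ((_≢ w) ∘ proj₂) f → coeffᴷ f w ≈ 0#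
  coeff-absent absent =
    ≈-reflexive (cong (List.foldr _+_ 0# ∘ List.map proj₁) (List.filter-none _ absent))

  coeff-mono-same : ∀ u → coeffᴷ (monoᴷ u) u ≈ 1#
  coeff-mono-same u with u ≟ᵐ u
  ... | yes _  = +-identityʳ 1#
  ... | no u≢u = contradiction refl u≢u

  coeff-mono-other : ∀ {u w} → u ≢ w → coeffᴷ (monoᴷ u) w ≈ 0#
  coeff-mono-other u≢w = coeff-absent (u≢w ∷ [])

  coeff-term : ∀ a u w → coeffᴷ ((a , u) ∷ []) w ≈ a * coeffᴷ (monoᴷ u) w
  coeff-term a u w with does (u ≟ᵐ w)
  ... | true  = ≈-trans (+-identityʳ a) (≈-sym (≈-trans (*-congˡ (+-identityʳ 1#)) (*-identityʳ a)))
  ... | false = ≈-sym (zeroʳ a)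

  -- The linear extension of `φ` from monomials to formal sums. Coefficients of a polynomial and of
  -- its product with a fixed factor both take this form, so they are determined by values on
  -- monomials.
  linear : (Monomial → Carrier) → Polyᴷ → Carrier
  linear φ = List.foldr (λ (a , u) s → a * φ u + s) 0#

  linear-zero : ∀ φ f → All (λ (_ , u) → φ u ≈ 0#) f → linear φ f ≈ 0#
  linear-zero φ []            []         = ≈-refl
  linear-zero φ ((a , u) ∷ f) (p ∷ ps) =
    ≈-trans (+-cong (≈-trans (*-congˡ p) (zeroʳ a)) (linear-zero φ f ps)) (+-identityˡ 0#)

  linear-tabulate : ∀ {n} φ (x : Fin n → Carrier) (u : Fin n → Monomial) →
    linear φ (List.tabulate (λ i → x i , u i)) ≡ sumᴷ (λ i → x i * φ (u i))
  linear-tabulate {zero}  φ x u = refl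
  linear-tabulate {suc n} φ x u =
    cong (λ s → x zero * φ (u zero) + s) (linear-tabulate φ (x ∘ suc) (u ∘ suc))

  -- Exchange of summation. It merges a kernel vector and a family of functionals into a single
  -- functional.
  sum-linear : ∀ {n} (x : Fin n → Carrier) (φ : Fin n → Monomial → Carrier) f →
    sumᴷ (λ i → x i * linear (φ i) f) ≈ linear (λ u → sumᴷ (λ i → x i * φ i u)) f
  sum-linear x φ []            = sum-zero _ (λ i → zeroʳ (x i))
  sum-linear x φ ((a , u) ∷ f) = begin
    sumᴷ (λ i → x i * (a * φ i u + linear (φ i) f))
      ≈⟨ sum-cong-≋ (λ i → ≈-trans (distribˡ (x i) _ _) (+-congʳ (x∙yz≈y∙xz (x i) a (φ i u)))) ⟩
    sumᴷ (λ i → a * (x i * φ i u) + x i * linear (φ i) f)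
      ≈⟨ ∑-distrib-+ (λ i → a * (x i * φ i u)) (λ i → x i * linear (φ i) f) ⟩
    sumᴷ (λ i → a * (x i * φ i u)) + sumᴷ (λ i → x i * linear (φ i) f)
      ≈⟨ +-cong (≈-sym (*-distribˡ-sum a (λ i → x i * φ i u))) (sum-linear x φ f) ⟩
    a * sumᴷ (λ i → x i * φ i u) + linear (λ u → sumᴷ (λ i → x i * φ i u)) f ∎

  coeff-linear : ∀ f w → coeffᴷ f w ≈ linear (λ u → coeffᴷ (monoᴷ u) w) f
  coeff-linear []            w = ≈-refl
  coeff-linear ((a , u) ∷ f) w = ≈-trans (coeff-++ ((a , u) ∷ []) f w)
    (+-cong (coeff-term a u w) (coeff-linear f w))

  -- `_*ᴾ_` recurses on its left factor, so additivity in the right factor holds coefficientwise,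
  -- after regrouping the terms.
  coeff-*-∷ : ∀ l t f w →
    coeffᴷ (l *ᴾᴷ (t ∷ f)) w ≈ coeffᴷ (l *ᴾᴷ (t ∷ [])) w + coeffᴷ (l *ᴾᴷ f) w
  coeff-*-∷ []            t         f w = ≈-sym (+-identityˡ 0#)
  coeff-*-∷ ((a , u) ∷ l) (b , v) f w = begin
    coeffᴷ (s ++ (sf ++ l *ᴾᴷ ((b , v) ∷ f))) w
      ≈⟨ coeff-++ s _ w ⟩
    coeffᴷ s w + coeffᴷ (sf ++ l *ᴾᴷ ((b , v) ∷ f)) w
      ≈⟨ +-congˡ (≈-trans (coeff-++ sf _ w) (+-congˡ (coeff-*-∷ l (b , v) f w))) ⟩
    coeffᴷ s w + (coeffᴷ sf w + (coeffᴷ (l *ᴾᴷ ((b , v) ∷ [])) w + coeffᴷ (l *ᴾᴷ f) w))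
      ≈⟨ ≈-trans (≈-sym (+-assoc _ _ _)) (+-interchange _ _ _ _) ⟩
    coeffᴷ s w + coeffᴷ (l *ᴾᴷ ((b , v) ∷ [])) w + (coeffᴷ sf w + coeffᴷ (l *ᴾᴷ f) w)
      ≈⟨ +-cong (coeff-++ s _ w) (coeff-++ sf _ w) ⟨
    coeffᴷ (s ++ l *ᴾᴷ ((b , v) ∷ [])) w + coeffᴷ (sf ++ l *ᴾᴷ f) w ∎
    where
    s  = (a * b , u ·ᵐ v) ∷ []
    sf = List.map (λ (b , v) → a * b , u ·ᵐ v) f

  coeff-*-term : ∀ l b v w → coeffᴷ (l *ᴾᴷ ((b , v) ∷ [])) w ≈ b * coeffᴷ (l *ᴾᴷ monoᴷ v) w
  coeff-*-term []            b v w = ≈-sym (zeroʳ b)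
  coeff-*-term ((a , u) ∷ l) b v w = begin
    coeffᴷ ((a * b , u ·ᵐ v) ∷ l *ᴾᴷ ((b , v) ∷ [])) w
      ≈⟨ coeff-++ ((a * b , u ·ᵐ v) ∷ []) _ w ⟩
    coeffᴷ ((a * b , u ·ᵐ v) ∷ []) w + coeffᴷ (l *ᴾᴷ ((b , v) ∷ [])) w
      ≈⟨ +-cong (≈-trans (coeff-term (a * b) (u ·ᵐ v) w)
                  (≈-trans (*-congʳ (*-comm a b)) (*-assoc b a _)))
                (coeff-*-term l b v w) ⟩
    b * (a * e) + b * coeffᴷ (l *ᴾᴷ monoᴷ v) w
      ≈⟨ distribˡ b _ _ ⟨
    b * (a * e + coeffᴷ (l *ᴾᴷ monoᴷ v) w)
      ≈⟨ *-congˡ (+-congʳ (≈-trans (coeff-term (a * 1#) (u ·ᵐ v) w) (*-congʳ (*-identityʳ a)))) ⟨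
    b * (coeffᴷ ((a * 1# , u ·ᵐ v) ∷ []) w + coeffᴷ (l *ᴾᴷ monoᴷ v) w)
      ≈⟨ *-congˡ (coeff-++ ((a * 1# , u ·ᵐ v) ∷ []) _ w) ⟨
    b * coeffᴷ ((a * 1# , u ·ᵐ v) ∷ l *ᴾᴷ monoᴷ v) w ∎
    where e = coeffᴷ (monoᴷ (u ·ᵐ v)) w

  -- The matrix of multiplication by `l` in the monomial basis has the entries
  -- `coeffᴷ (l *ᴾᴷ monoᴷ u) w`.
  coeff-* : ∀ l f w → coeffᴷ (l *ᴾᴷ f) w ≈ linear (λ u → coeffᴷ (l *ᴾᴷ monoᴷ u) w) f
  coeff-* l []            w = *ᴾ-[] l
    where
    *ᴾ-[] : ∀ l → coeffᴷ (l *ᴾᴷ []) w ≈ 0#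
    *ᴾ-[] []      = ≈-refl
    *ᴾ-[] (_ ∷ l) = *ᴾ-[] l
  coeff-* l ((b , v) ∷ f) w =
    ≈-trans (coeff-*-∷ l (b , v) f w) (+-cong (coeff-*-term l b v w) (coeff-* l f w))

  coeff-multiple : ∀ h {u w} → ¬ u ∣ᵐ w → coeffᴷ (h *ᴾᴷ monoᴷ u) w ≈ 0#
  coeff-multiple h {u} {w} u∤w = coeff-absent (absent h)
    where
    absent : ∀ h → All ((_≢ w) ∘ proj₂) (h *ᴾᴷ monoᴷ u)
    absent []            = []
    absent ((a , v) ∷ h) = (λ { refl → u∤w (u∣ᵐv·u v u) }) ∷ absent h

  -- Membership in a monomial ideal.

  module _ {t} (g : Vec Monomial t) where

    combination : List (Polyᴷ × Fin t) → Polyᴷ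
    combination hs =
      List.foldr (_+ᴾ_ K) (0ᴾ K) (List.map (λ (h , s) → h *ᴾᴷ monoᴷ (lookup g s)) hs)

    coeff-combination : ∀ hs {w} → ¬ w ∈⟨ g ⟩ → coeffᴷ (combination hs) w ≈ 0#
    coeff-combination []             w∉ = ≈-refl
    coeff-combination ((h , s) ∷ hs) {w} w∉ = ≈-trans
      (coeff-++ (h *ᴾᴷ monoᴷ (lookup g s)) (combination hs) w)
      (≈-trans (+-cong (coeff-multiple h (w∉ ∘ ∈⟨⟩⁺ g s)) (coeff-combination hs w∉))
               (+-identityˡ 0#))
      where
      ∈⟨⟩⁺ : ∀ {t} (g : Vec Monomial t) s {w} → lookup g s ∣ᵐ w → w ∈⟨ g ⟩
      ∈⟨⟩⁺ (h ∷ g) zero    p = here p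
      ∈⟨⟩⁺ (h ∷ g) (suc s) p = there (∈⟨⟩⁺ g s p)

    ideal⇒coeff≈0 : ∀ f → monomialIdeal K g f → ∀ {w} → ¬ w ∈⟨ g ⟩ → coeffᴷ f w ≈ 0#
    ideal⇒coeff≈0 f (hs , f≈) {w} w∉ = ≈-trans (f≈ w) (coeff-combination hs w∉)

    -- Terms at monomials outside the ideal are dropped: a formal sum may contain such terms even
    -- when they cancel, and only their total coefficient is known to vanish.
    quotients : Polyᴷ → List (Polyᴷ × Fin t)
    quotients []            = []
    quotients ((a , u) ∷ f) with u ∈⟨ g ⟩?
    ... | yes u∈ = ((a , Vec.zipWith _∸_ u (lookup g s)) ∷ [] , s) ∷ quotients f
      where s = VecAny.index u∈
    ... | no _   = quotients f

    coeff-quotients : ∀ f {w} → w ∈⟨ g ⟩ → coeffᴷ f w ≈ coeffᴷ (combination (quotients f)) w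
    coeff-quotients []            w∈ = ≈-refl
    coeff-quotients ((a , u) ∷ f) {w} w∈ with u ∈⟨ g ⟩?
    ... | no u∉  = begin
      coeffᴷ ((a , u) ∷ f) w                      ≈⟨ coeff-++ ((a , u) ∷ []) f w ⟩
      coeffᴷ ((a , u) ∷ []) w + coeffᴷ f w
        ≈⟨ +-cong (coeff-absent {(a , u) ∷ []} ((λ { refl → u∉ w∈ }) ∷ []))
                  (coeff-quotients f w∈) ⟩
      0# + coeffᴷ (combination (quotients f)) w   ≈⟨ +-identityˡ _ ⟩
      coeffᴷ (combination (quotients f)) w        ∎
    -- The rewrite makes the first term of the combination a term at `u` itself. Its coefficient is
    -- `a * 1#`, the factor `1#` coming from `mono`.
    ... | yes u∈ rewrite quotient·divisor (VecAny.lookup-index u∈) = begin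
      coeffᴷ ((a , u) ∷ f) w                      ≈⟨ coeff-++ ((a , u) ∷ []) f w ⟩
      coeffᴷ ((a , u) ∷ []) w + coeffᴷ f w
        ≈⟨ +-cong (≈-trans (coeff-term a u w) (≈-trans (*-congʳ (≈-sym (*-identityʳ a)))
                    (≈-sym (coeff-term (a * 1#) u w))))
                  (coeff-quotients f w∈) ⟩
      coeffᴷ ((a * 1# , u) ∷ []) w + coeffᴷ (combination (quotients f)) w
        ≈⟨ coeff-++ ((a * 1# , u) ∷ []) _ w ⟨
      coeffᴷ ((a * 1# , u) ∷ combination (quotients f)) w ∎

    -- With `ideal⇒coeff≈0`, reduces congruence modulo the ideal to a comparison of coefficients at
    -- monomials outside it.
    coeff≈0⇒ideal : ∀ f → (∀ w → ¬ w ∈⟨ g ⟩ → coeffᴷ f w ≈ 0#) → monomialIdeal K g f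
    coeff≈0⇒ideal f f≈0 = quotients f , agree
      where
      agree : ∀ w → coeffᴷ f w ≈ coeffᴷ (combination (quotients f)) w
      agree w with w ∈⟨ g ⟩?
      ... | yes w∈ = coeff-quotients f w∈
      ... | no w∉  = ≈-trans (f≈0 w w∉) (≈-sym (coeff-combination (quotients f) w∉))

    coeff--ᴾ : ∀ f h w → coeffᴷ (_-ᴾ_ K f h) w ≈ coeffᴷ f w - coeffᴷ h w
    coeff--ᴾ f h w = ≈-trans (coeff-++ f (-ᴾ_ K h) w) (+-congˡ (coeff-neg h w))

    -- Maximal rank and Hilbert functions.

    module _ (ℓ : Form K 1) (n : ℕ) where

      private
        l = proj₁ ℓ
        I = monomialIdeal K g

      entry : Monomial → Monomial → Carrier
      entry u w = coeffᴷ (l *ᴾᴷ monoᴷ u) w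

      -- Were the dimension to drop, the matrix of `ℓ` on the ideal of `m` in R/I would have more
      -- rows than columns. A kernel vector is then a combination of standard monomials that `ℓ`
      -- kills in R/I, and injectivity contradicts their independence modulo I.
      injective⇒hilbert≤ : ∀ m →
        Injective (_≈ᶠ_ K I {n}) (_≈ᶠ_ K I {suc n}) (mulForm K ℓ) →
        hilbert m g n ≤ⁿ hilbert m g (suc n)
      injective⇒hilbert≤ m inj = ℕ.≮⇒≥ λ lt →
        ∃-leftKernel lt (λ i j → entry (u i) (w j)) λ { (x , (i , xi#0) , xM≈0) →
          #-irrefl (xi≈0 x xM≈0 i) xi#0 }
        where
        u = List.lookup (standards m g n)
        w = List.lookup (standards m g (suc n))

        module _ x (xM≈0 : LeftKernel (λ i j → entry (u i) (w j)) x) where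

          f : Polyᴷ
          f = List.tabulate (λ i → x i , u i)

          fᶠ : Form K n
          fᶠ = f , All.tabulate⁺ (standards-deg m g n)

          -- The kernel equations only cover standard multiples of `m` in degree `n + 1`. Other
          -- coefficients outside I vanish because the product is homogeneous and every term of `f`
          -- is a multiple of `m`.
          ℓf≈0 : ∀ v → ¬ v ∈⟨ g ⟩ → coeffᴷ (l *ᴾᴷ f) v ≈ 0#
          ℓf≈0 v v∉ with deg v ℕ.≟ suc n | m ∣ᵐ? v
          ... | no deg≢ | _ = coeff-absent
            (All.map (λ { eq refl → deg≢ eq }) (proj₂ (mulForm K ℓ fᶠ)))
          ... | yes _   | no m∤v = ≈-trans (coeff-* l f v) (linear-zero _ f
            (All.tabulate⁺ λ i → coeff-multiple l
              (m∤v ∘ ∣ᵐ-trans (proj₁ (standards-standard m g n i)))))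
          ... | yes deg≡ | yes m∣v = begin
            coeffᴷ (l *ᴾᴷ f) v           ≈⟨ coeff-* l f v ⟩
            linear (λ u → entry u v) f   ≡⟨ linear-tabulate (λ u → entry u v) x u ⟩
            sumᴷ (λ i → x i * entry (u i) v)
              ≡⟨ cong (λ v → sumᴷ (λ i → x i * entry (u i) v)) (ListAny.lookup-index v∈) ⟩
            sumᴷ (λ i → x i * entry (u i) (w (ListAny.index v∈)))
              ≈⟨ xM≈0 _ ⟩
            0# ∎
            where v∈ = ∈-standards⁺ m g deg≡ (m∣v , v∉)

          f∈I : I (_-ᴾ_ K f [])
          -- Injectivity compares `f` with the zero form `[]`, which is why differences with an
          -- empty sum appear.
          f∈I = inj {fᶠ} {[] , []} (coeff≈0⇒ideal (_-ᴾ_ K (l *ᴾᴷ f) (l *ᴾᴷ [])) λ v v∉ → begin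
            coeffᴷ (_-ᴾ_ K (l *ᴾᴷ f) (l *ᴾᴷ [])) v
              ≈⟨ coeff--ᴾ (l *ᴾᴷ f) (l *ᴾᴷ []) v ⟩
            coeffᴷ (l *ᴾᴷ f) v - coeffᴷ (l *ᴾᴷ []) v
              ≈⟨ +-cong (ℓf≈0 v v∉) (-‿cong (coeff-* l [] v)) ⟩
            0# - 0#   ≈⟨ -‿inverseʳ 0# ⟩
            0#        ∎)

          xi≈0 : ∀ i → x i ≈ 0#
          xi≈0 i = begin
            x i        ≈⟨ *-identityʳ (x i) ⟨
            x i * 1#   ≈⟨ *-congˡ (coeff-mono-same (u i)) ⟨
            x i * coeffᴷ (monoᴷ (u i)) (u i)
              ≈⟨ sum-only (λ j → x j * coeffᴷ (monoᴷ (u j)) (u i)) i (λ j j≢i →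
                   ≈-trans (*-congˡ (coeff-mono-other (standards-distinct m g n j i j≢i)))
                           (zeroʳ (x j))) ⟨
            sumᴷ (λ j → x j * coeffᴷ (monoᴷ (u j)) (u i))
              ≡⟨ linear-tabulate (λ v → coeffᴷ (monoᴷ v) (u i)) x u ⟨
            linear (λ v → coeffᴷ (monoᴷ v) (u i)) f
              ≈⟨ coeff-linear f (u i) ⟨
            coeffᴷ f (u i)
              ≡⟨ cong (λ f → coeffᴷ f (u i)) (List.++-identityʳ f) ⟨
            coeffᴷ (_-ᴾ_ K f []) (u i)
              ≈⟨ ideal⇒coeff≈0 (_-ᴾ_ K f []) f∈I (proj₂ (standards-standard m g n i)) ⟩
            0# ∎

      -- The dual argument, with the transposed matrix: growth of R/(I + (m)) would give a nonzero
      -- functional in degree `n + 1` vanishing on the image of `ℓ`, while surjectivity makes every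
      -- standard monomial such an image modulo I.
      surjective⇒hilbert≥ : ∀ m →
        StrictlySurjective (_≈ᶠ_ K I {suc n}) (mulForm K {1} {n} ℓ) →
        hilbert 1ᵐ (m ∷ g) (suc n) ≤ⁿ hilbert 1ᵐ (m ∷ g) n
      surjective⇒hilbert≥ m surj = ℕ.≮⇒≥ λ lt →
        ∃-leftKernel lt (λ i j → entry (v j) (u i)) λ { (x , (i , xi#0) , xM≈0) →
          #-irrefl (xi≈0 x xM≈0 i) xi#0 }
        where
        u = List.lookup (standards 1ᵐ (m ∷ g) (suc n))
        v = List.lookup (standards 1ᵐ (m ∷ g) n)

        u∉ : ∀ i → ¬ u i ∈⟨ m ∷ g ⟩
        u∉ i = proj₂ (standards-standard 1ᵐ (m ∷ g) (suc n) i)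

        module _ x (xM≈0 : LeftKernel (λ i j → entry (v j) (u i)) x) where

          -- A functional in degree n + 1 that kills I + (m) and the image of ℓ.
          φ : Monomial → Carrier
          φ v = sumᴷ (λ i → x i * entry v (u i))

          -- If `v` lies in I + (m), so do its multiples, and none of them is standard; otherwise
          -- `v` is standard and the claim is one of the kernel equations.
          φ≈0 : ∀ {v} → deg v ≡ n → φ v ≈ 0#
          φ≈0 {v′} deg≡ with v′ ∈⟨ m ∷ g ⟩?
          ... | yes v∈ = sum-zero _ λ i → ≈-trans
            (*-congˡ (coeff-multiple l (λ v∣u → u∉ i (VecAny.map (λ p → ∣ᵐ-trans p v∣u) v∈))))
            (zeroʳ (x i))
          ... | no v∉ = ≈-trans
            (≈-reflexive (cong φ (ListAny.lookup-index v∈))) (xM≈0 (ListAny.index v∈))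
            where v∈ = ∈-standards⁺ 1ᵐ (m ∷ g) deg≡ (1∣ᵐ v′ , v∉)

          xi≈0 : ∀ i → x i ≈ 0#
          xi≈0 i
            -- With `h` a preimage of `u i` modulo I, the value of `φ` on `h` is `x i`, read off
            -- from the coefficients of the product, and also 0 by `φ≈0`.
            with (h , h-deg) , ℓh≈u ←
                   surj (monoᴷ (u i) , standards-deg 1ᵐ (m ∷ g) (suc n) i ∷ []) = begin
            x i        ≈⟨ *-identityʳ (x i) ⟨
            x i * 1#   ≈⟨ *-congˡ (coeff-mono-same (u i)) ⟨
            x i * coeffᴷ (monoᴷ (u i)) (u i)
              ≈⟨ sum-only (λ j → x j * coeffᴷ (monoᴷ (u i)) (u j)) i (λ j j≢i →
                   ≈-trans (*-congˡ (coeff-mono-other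
                             (standards-distinct 1ᵐ (m ∷ g) (suc n) i j (j≢i ∘ sym))))
                           (zeroʳ (x j))) ⟨
            sumᴷ (λ j → x j * coeffᴷ (monoᴷ (u i)) (u j))
              ≈⟨ sum-cong-≋ (λ j → *-congˡ (ℓh≈u-at j)) ⟨
            sumᴷ (λ j → x j * coeffᴷ (l *ᴾᴷ h) (u j))
              ≈⟨ sum-cong-≋ (λ j → *-congˡ (coeff-* l h (u j))) ⟩
            sumᴷ (λ j → x j * linear (λ v → entry v (u j)) h)
              ≈⟨ sum-linear x (λ j v → entry v (u j)) h ⟩
            linear φ h
              ≈⟨ linear-zero φ h (All.map φ≈0 h-deg) ⟩
            0# ∎
            where
            ℓh≈u-at : ∀ j → coeffᴷ (l *ᴾᴷ h) (u j) ≈ coeffᴷ (monoᴷ (u i)) (u j)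
            ℓh≈u-at j = x-y≈0⇒x≈y _ _ (≈-trans (≈-sym (coeff--ᴾ (l *ᴾᴷ h) (monoᴷ (u i)) (u j)))
              (ideal⇒coeff≈0 (_-ᴾ_ K (l *ᴾᴷ h) (monoᴷ (u i))) ℓh≈u (u∉ j ∘ there)))

-- Comparison of fractions.

/-injective : ∀ i j a b .{{_ : NonZero a}} .{{_ : NonZero b}} →
              i / a ≡ j / b → i ℤ.* + b ≡ j ℤ.* + a
/-injective i j (suc a) (suc b) eq
  with *≡* p ← ℚ.fromℚᵘ-injective {mkℚᵘ i a} {mkℚᵘ j b} eq = p

-- `_/_` reduces to lowest terms, so cross multiplication takes place among unnormalised fractions,
-- where a denominator `suc a` is recorded as `a`.
/-mono-≤ : ∀ i j a b .{{_ : NonZero a}} .{{_ : NonZero b}} →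
           i ℤ.* + b ℤ.≤ j ℤ.* + a → i / a ≤ j / b
/-mono-≤ i j (suc a) (suc b) i≤j = ℚ.toℚᵘ-cancel-≤
  (ℚᵘ.≤-respˡ-≃ (ℚᵘ.≃-sym (ℚ.toℚᵘ-fromℚᵘ (mkℚᵘ i a)))
  (ℚᵘ.≤-respʳ-≃ (ℚᵘ.≃-sym (ℚ.toℚᵘ-fromℚᵘ (mkℚᵘ j b))) (*≤* i≤j)))

/1-cancel-≤ : ∀ {i j} → i / 1 ≤ j / 1 → i ℤ.≤ j
/1-cancel-≤ {i} {j} i≤j
  with *≤* p ← ℚᵘ.≤-respˡ-≃ (ℚ.toℚᵘ-fromℚᵘ (mkℚᵘ i 0))
                 (ℚᵘ.≤-respʳ-≃ (ℚ.toℚᵘ-fromℚᵘ (mkℚᵘ j 0)) (ℚ.toℚᵘ-mono-≤ i≤j)) =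
  ℤ.*-cancelʳ-≤-pos i j (+ 1) p

/1-cancel-< : ∀ {i j} → i / 1 < j / 1 → i ℤ.< j
/1-cancel-< {i} {j} i<j
  with *<* p ← ℚᵘ.<-respˡ-≃ (ℚ.toℚᵘ-fromℚᵘ (mkℚᵘ i 0))
                 (ℚᵘ.<-respʳ-≃ (ℚ.toℚᵘ-fromℚᵘ (mkℚᵘ j 0)) (ℚ.toℚᵘ-mono-< i<j)) =
  ℤ.*-cancelʳ-<-nonNeg {i} {j} (+ 1) p

-- Degree sums over families of generators.

sum-complement : ∀ D {hs} → All (λ h → deg h ≤ⁿ D) hs →
                 sum (List.map (λ h → D ∸ deg h) hs) +ⁿ degreeSum hs ≡ length hs *ⁿ D
sum-complement D []       = refl
sum-complement D {h ∷ hs} (p ∷ ps) = trans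
  (interchange (D ∸ deg h) _ (deg h) _)
  (cong₂ _+ⁿ_ (ℕ.m∸n+n≡m p) (sum-complement D ps))

↾-All : ∀ {p t} {P : Pred Monomial p} (g : Vec Monomial t) J →
        (∀ i → P (lookup g i)) → All P (g ↾ J)
↾-All []      []          Pg = []
↾-All (h ∷ g) (true ∷ J)  Pg = Pg zero ∷ ↾-All g J (Pg ∘ suc)
↾-All (h ∷ g) (false ∷ J) Pg = ↾-All g J (Pg ∘ suc)

toList-All : ∀ {p t} {P : Pred Monomial p} (g : Vec Monomial t) →
             (∀ i → P (lookup g i)) → All P (toList g)
toList-All []      Pg = []
toList-All (h ∷ g) Pg = Pg zero ∷ toList-All g (Pg ∘ suc)

length-↾ : ∀ {t} (g : Vec Monomial t) J → length (g ↾ J) ≡ ∣ J ∣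
length-↾ []      []          = refl
length-↾ (h ∷ g) (true ∷ J)  = cong suc (length-↾ g J)
length-↾ (h ∷ g) (false ∷ J) = length-↾ g J

-- For `h` selected by `J`, the lcm with its divisor `m` is `h` itself; the terms outside `J` are
-- nonnegative and are discarded.
sum-↾≤ : ∀ {t} D m (g : Vec Monomial t) J → All (m ∣ᵐ_) (g ↾ J) →
  sum (List.map (λ h → D ∸ deg h) (g ↾ J)) ≤ⁿ
  sum (List.map (λ h → D ∸ deg (lcmᵐ m h)) (toList g))
sum-↾≤ D m []      []          ps       = z≤n
sum-↾≤ D m (h ∷ g) (true ∷ J)  (p ∷ ps) = ℕ.+-mono-≤
  (ℕ.≤-reflexive (cong (λ u → D ∸ deg u) (sym (lcm-absorbs p)))) (sum-↾≤ D m g J ps)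
sum-↾≤ D m (h ∷ g) (false ∷ J) ps       =
  ℕ.≤-trans (sum-↾≤ D m g J ps) (ℕ.m≤n+m _ _)

deg-divisor≤ : ∀ {D m} hs .{{_ : NonZero (length hs)}} →
               All (λ h → deg h ≤ⁿ D) hs → All (m ∣ᵐ_) hs → deg m ≤ⁿ D
deg-divisor≤ (h ∷ hs) (h≤D ∷ _) (m∣h ∷ _) = ℕ.≤-trans (∣ᵐ⇒sum≤ m∣h) h≤D

-- Brenner's inequality from degrees d - 2 = `n` and d - 1.

module _ {t} (g : Vec Monomial (suc t)) (n : ℕ)
  (big : ∀ i j → i ≢ j → suc (suc n) ≤ⁿ deg (lcmᵐ (lookup g i) (lookup g j)))
  (small : ∀ i → deg (lookup g i) ≤ⁿ suc (suc n))
  (sum-deg : degreeSum (toList g) ≡ suc (suc n) *ⁿ t)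
  where

  private
    D : ℕ
    D = suc (suc n)

  -- There are `suc t` generators of total degree `D *ⁿ t`, so their defects from `D` add up to `D`.
  -- This is also the growth term of `hilbert-step`, as `deg 1ᵐ` computes to 0.
  hilbert-balanced : hilbert 1ᵐ g (suc n) ≡ hilbert 1ᵐ g n
  hilbert-balanced = ℕ.+-cancelʳ-≡ D _ _ (trans
    (cong (hilbert 1ᵐ g (suc n) +ⁿ_) (sym Σ≡D)) (hilbert-step 1ᵐ g n big))
    where
    Σ = sum (List.map (λ h → D ∸ deg (lcmᵐ 1ᵐ h)) (toList g))

    Σ≡D : Σ ≡ D
    Σ≡D = ℕ.+-cancelʳ-≡ (degreeSum (toList g)) _ _ (begin
      Σ +ⁿ degreeSum (toList g)
        ≡⟨ cong (λ xs → sum xs +ⁿ degreeSum (toList g))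
             (List.map-cong (λ h → cong (λ u → D ∸ deg u) (lcm-absorbs (1∣ᵐ h))) (toList g)) ⟩
      sum (List.map (λ h → D ∸ deg h) (toList g)) +ⁿ degreeSum (toList g)
        ≡⟨ sum-complement D (toList-All g small) ⟩
      length (toList g) *ⁿ D    ≡⟨ cong (_*ⁿ D) (Vec.length-toList g) ⟩
      suc t *ⁿ D                ≡⟨ cong (D +ⁿ_) (ℕ.*-comm t D) ⟩
      D +ⁿ D *ⁿ t               ≡⟨ cong (D +ⁿ_) sum-deg ⟨
      D +ⁿ degreeSum (toList g) ∎)
      where open ≡-Reasoning

  WLP⇒hilbert≤ : ∀ {c ℓ₁ ℓ₂} (K : HeytingField c ℓ₁ ℓ₂) →
                 QuotientHasWLP K (monomialIdeal K g) →
                 ∀ m → hilbert m g n ≤ⁿ hilbert m g (suc n)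
  WLP⇒hilbert≤ K (ℓ , maximal-rank) m with maximal-rank n
  ... | inj₁ inj  = injective⇒hilbert≤ K g ℓ n m (λ {f} {h} → inj {f} {h})
  -- The dimension of R/I is the same in both degrees and that of R/(I + (m)) does not grow, so that
  -- of the ideal of `m` does not drop.
  ... | inj₂ surj = ℕ.+-cancelʳ-≤ (hilbert 1ᵐ (m ∷ g) n) _ _ (begin
    hilbert m g n +ⁿ hilbert 1ᵐ (m ∷ g) n ≡⟨ hilbert-quotient m g n ⟨
    hilbert 1ᵐ g n                        ≡⟨ hilbert-balanced ⟨
    hilbert 1ᵐ g (suc n)                  ≡⟨ hilbert-quotient m g (suc n) ⟩
    hilbert m g (suc n) +ⁿ hilbert 1ᵐ (m ∷ g) (suc n)
      ≤⟨ ℕ.+-monoʳ-≤ _ (surjective⇒hilbert≥ K g ℓ n m surj) ⟩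
    hilbert m g (suc n) +ⁿ hilbert 1ᵐ (m ∷ g) n       ∎)
    where open ℕ.≤-Reasoning

  -- Brenner's inequality for `J` with denominators cleared, where `p` is the size of `J` minus one.
  -- Adding `D` to both sides lets each of the `suc p` generators contribute one `D`.
  semistable-bound : (∀ m → hilbert m g n ≤ⁿ hilbert m g (suc n)) →
    ∀ J {p} → ∣ J ∣ ≡ suc p → D *ⁿ p +ⁿ deg (gcds (g ↾ J)) ≤ⁿ degreeSum (g ↾ J)
  semistable-bound hilbert≤ J {p} ∣J∣≡ = ℕ.+-cancelˡ-≤ D _ _ (begin
    D +ⁿ (D *ⁿ p +ⁿ deg m)     ≡⟨ ℕ.+-assoc D _ _ ⟨
    D +ⁿ D *ⁿ p +ⁿ deg m       ≡⟨ cong (λ x → D +ⁿ x +ⁿ deg m) (ℕ.*-comm D p) ⟩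
    suc p *ⁿ D +ⁿ deg m        ≡⟨ cong (λ k → k *ⁿ D +ⁿ deg m) length≡ ⟨
    length hs *ⁿ D +ⁿ deg m    ≡⟨ cong (_+ⁿ deg m) (sum-complement D hs-small) ⟨
    Σ +ⁿ degreeSum hs +ⁿ deg m ≤⟨ ℕ.+-monoˡ-≤ (deg m) (ℕ.+-monoˡ-≤ (degreeSum hs)
                                          (ℕ.≤-trans (sum-↾≤ D m g J m∣hs) Σ-lcm≤)) ⟩
    (D ∸ deg m) +ⁿ degreeSum hs +ⁿ deg m ≡⟨ xy∙z≈xz∙y (D ∸ deg m) _ _ ⟩
    (D ∸ deg m) +ⁿ deg m +ⁿ degreeSum hs ≡⟨ cong (_+ⁿ degreeSum hs) (ℕ.m∸n+n≡m m≤D) ⟩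
    D +ⁿ degreeSum hs                    ∎)
    where
    open ℕ.≤-Reasoning
    hs = g ↾ J
    m  = gcds hs
    Σ  = sum (List.map (λ h → D ∸ deg h) hs)

    length≡ : length hs ≡ suc p
    length≡ = trans (length-↾ g J) ∣J∣≡

    hs-small : All (λ h → deg h ≤ⁿ D) hs
    hs-small = ↾-All g J small

    m∣hs : All (m ∣ᵐ_) hs
    m∣hs = gcds-divides hs

    -- Makes `D ∸ deg m` a genuine difference: `J` is nonempty, so `m` divides some generator.
    m≤D : deg m ≤ⁿ D
    m≤D = deg-divisor≤ hs {{subst NonZero (sym length≡) _}} hs-small m∣hs

    -- Since `hilbert` does not drop, the defects of the lcms cannot exceed the growth term in
    -- `hilbert-step`.
    Σ-lcm≤ : sum (List.map (λ h → D ∸ deg (lcmᵐ m h)) (toList g)) ≤ⁿ D ∸ deg m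
    Σ-lcm≤ = ℕ.+-cancelˡ-≤ (hilbert m g n) _ _ (ℕ.≤-trans
      (ℕ.+-monoˡ-≤ _ (hilbert≤ m)) (ℕ.≤-reflexive (hilbert-step m g n big)))

-- The slope of the full family is `- D`, so comparing slopes amounts to `D *ⁿ p +ⁿ e ≤ⁿ s`.
slope≤ : ∀ D {e s S} p t → S ≡ D *ⁿ t → D *ⁿ p +ⁿ e ≤ⁿ s →
         (+ e ℤ.- + s) ℤ.* + t ℤ.≤ (ℤ.- + S) ℤ.* + p
slope≤ D {e} {s} p t refl Dp+e≤s = begin
  (+ e ℤ.- + s) ℤ.* + t
    ≤⟨ ℤ.*-monoʳ-≤-nonNeg (+ t) (ℤ.+-monoʳ-≤ (+ e) (ℤ.neg-mono-≤ (ℤ.+≤+ Dp+e≤s))) ⟩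
  (+ e ℤ.- + (D *ⁿ p +ⁿ e)) ℤ.* + t
    ≡⟨ cong (λ x → (+ e ℤ.- x) ℤ.* + t)
         (trans (ℤ.pos-+ (D *ⁿ p) e) (cong (ℤ._+ + e) (ℤ.pos-* D p))) ⟩
  (+ e ℤ.- (+ D ℤ.* + p ℤ.+ + e)) ℤ.* + t
    ≡⟨ rearrange (+ D) (+ e) (+ p) (+ t) ⟩
  (ℤ.- (+ D ℤ.* + t)) ℤ.* + p
    ≡⟨ cong (λ x → (ℤ.- x) ℤ.* + p) (ℤ.pos-* D t) ⟨
  (ℤ.- + (D *ⁿ t)) ℤ.* + p ∎
  where
  open ℤ.≤-Reasoning
  rearrange : ∀ D e p t → (e ℤ.- (D ℤ.* p ℤ.+ e)) ℤ.* t ≡ (ℤ.- (D ℤ.* t)) ℤ.* p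
  rearrange = ℤ.solve-∀

-- Reduction of the rational hypotheses to natural numbers.

suc-∸1 : ∀ n .{{_ : NonZero (n ∸ 1)}} → n ≡ suc (n ∸ 1)
suc-∸1 (suc n) = refl

-- For `D` equal to 1 both monomials would be 1, with lcm of degree 0. The bound makes d - 2 a
-- natural number.
pairwise-lcm⇒2≤ : ∀ {D} (u v : Monomial) → deg u <ⁿ D → deg v <ⁿ D →
                  D ≤ⁿ deg (lcmᵐ u v) → 2 ≤ⁿ D
pairwise-lcm⇒2≤ {suc (suc D)} u v _  _  _ = s≤s (s≤s z≤n)
pairwise-lcm⇒2≤ {suc zero} u v u<1 v<1 1≤lcm = contradiction
  (ℕ.≤-trans 1≤lcm (ℕ.≤-trans (sum-lcm≤ u v) (ℕ.+-mono-≤ (s≤s⁻¹ u<1) (s≤s⁻¹ v<1)))) λ ()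

theorem8p28 : ∀ {c ℓ₁ ℓ₂} (K : HeytingField c ℓ₁ ℓ₂) → CharacteristicZero K →
    ∀ {t} (g : Vec Monomial t) .{{_ : NonZero (t ∸ 1)}} →
    AreMinimalGenerators K g →
    QuotientIsArtinian K (monomialIdeal K g) →
    (d : ℚ) → d ≡ + degreeSum (toList g) / (t ∸ 1) →
    (∃ λ (k : ℤ) → d ≡ k / 1) →
    (∀ i → + deg (lookup g i) / 1 < d) →
    (∀ i j → i ≢ j → d ≤ + deg (lcmᵐ (lookup g i) (lookup g j)) / 1) →
    QuotientHasWLP K (monomialIdeal K g) →
    SyzygyBundleSemistable g
-- A nonzero `t ∸ 1` forces two generators, `g₀` and `g₁`, which later supply the bound on d.
-- Matching on `refl` replaces d by `k / 1`.
theorem8p28 K _ {suc (suc t)} g@(g₀ ∷ g₁ ∷ _) _ _ _ d≡ (k , refl) deg< ≤lcm wlp J _ =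
  semistable k d≡ (λ i → /1-cancel-< (deg< i)) (λ i j i≢j → /1-cancel-≤ (≤lcm i j i≢j))
  where
  Goal : .{{_ : NonZero (∣ J ∣ ∸ 1)}} → Set
  Goal = (+ deg (gcds (g ↾ J)) ℤ.- + degreeSum (g ↾ J)) / (∣ J ∣ ∸ 1)
           ≤ (ℤ.- + degreeSum (toList g)) / suc t

  bounded : ∀ D → 2 ≤ⁿ D → degreeSum (toList g) ≡ D *ⁿ suc t →
    (∀ i → deg (lookup g i) <ⁿ D) →
    (∀ i j → i ≢ j → D ≤ⁿ deg (lcmᵐ (lookup g i) (lookup g j))) →
    .{{_ : NonZero (∣ J ∣ ∸ 1)}} → Goal
  bounded (suc (suc n)) (s≤s (s≤s z≤n)) sum-deg deg< ≤lcm = /-mono-≤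
    (+ deg (gcds (g ↾ J)) ℤ.- + degreeSum (g ↾ J)) (ℤ.- + degreeSum (toList g))
    (∣ J ∣ ∸ 1) (suc t)
    (slope≤ (suc (suc n)) (∣ J ∣ ∸ 1) (suc t) sum-deg
      (semistable-bound g n ≤lcm small sum-deg
        (WLP⇒hilbert≤ g n ≤lcm small sum-deg K wlp) J (suc-∸1 ∣ J ∣)))
    where
    small : ∀ i → deg (lookup g i) ≤ⁿ suc (suc n)
    small i = ℕ.<⇒≤ (deg< i)

  semistable : ∀ k → k / 1 ≡ + degreeSum (toList g) / suc t →
    (∀ i → + deg (lookup g i) ℤ.< k) →
    (∀ i j → i ≢ j → k ℤ.≤ + deg (lcmᵐ (lookup g i) (lookup g j))) →
    .{{_ : NonZero (∣ J ∣ ∸ 1)}} → Goal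
  semistable -[1+ _ ] _    deg< _    = contradiction (deg< zero) λ ()
  semistable (+ D)    D/1≡ deg< ≤lcm = bounded D
    (pairwise-lcm⇒2≤ g₀ g₁ (ℤ.drop‿+<+ (deg< zero)) (ℤ.drop‿+<+ (deg< (suc zero)))
      (ℤ.drop‿+≤+ (≤lcm zero (suc zero) λ ())))
    sum-deg
    (λ i → ℤ.drop‿+<+ (deg< i))
    (λ i j i≢j → ℤ.drop‿+≤+ (≤lcm i j i≢j))
    where
    sum-deg : degreeSum (toList g) ≡ D *ⁿ suc t
    sum-deg = ℤ.+-injective (begin
      + degreeSum (toList g)           ≡⟨ ℤ.*-identityʳ _ ⟨
      + degreeSum (toList g) ℤ.* + 1
        ≡⟨ /-injective (+ D) (+ degreeSum (toList g)) 1 (suc t) D/1≡ ⟨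
      + D ℤ.* + suc t ≡⟨ ℤ.pos-* D (suc t) ⟨
      + (D *ⁿ suc t)  ∎)
      where open ≡-Reasoning
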